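{- Let $G$ be a connected claw-free graph with maximum degree $\Delta(G) \leq 3$ such that $G$ is not isomorphic to the 3-cycle $C_3$. Then $V(G)$ can be partitioned into four pairwise disjoint cycle isolating sets of $G$.
   Context: All graphs are simple, finite and undirected. A graph is claw-free if it contains no induced subgraph isomorphic to $K_{1,3}$. For $D \subseteq V(G)$, the closed neighborhood $N[D]$ is the set consisting of $D$ together with all vertices having a neighbor in $D$. A subset $D \subseteq V(G)$ is a cycle isolating set of $G$ if $G - N[D]$ contains no cycle (of any length $\geq 3$) as a subgraph. Partitions are weak, i.e. parts may be empty; equivalently, there is a map $c: V(G) \to \{1,2,3,4\}$ (not required to be surjective) such that each of the four color classes is a cycle isolating set of $G$. -}

module Defs where

open import Data.Empty using (⊥)
open import Data.Fin.Base using (Fin; toℕ)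
open import Data.Fin.Properties using (toℕ<n)
open import Data.Fin.Subset using (Subset; _∈_; _∩_; Empty; ∣_∣)
open import Data.List.Base using (map; allFin)
open import Data.List.Extrema.Nat using (max)
open import Data.Nat.Base using (ℕ; suc; _+_; _%_; _<_)
open import Data.Nat.DivMod using (m<n⇒m%n≡m; n%n≡0)
open import Data.Nat.Properties using (_≟_; m≤n⇒m<n∨m≡n; 1+n≢n)
open import Data.Product.Base using (_×_; _,_; ∃-syntax)
open import Data.Refinement using (Refinement-syntax; value)
open import Data.Sum.Base using (_⊎_; inj₁; inj₂; swap; [_,_])
open import Data.Unit.Base using (⊤; tt)
open import Data.Vec.Base using (tabulate)
open import Function.Base using (_on_; _∘_)
open import Function.Bundles using (_⇔_; _↔_; Inverse)
open import Function.Definitions using (Injective)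
open import Level using (0ℓ)
open import Relation.Binary.Construct.Closure.ReflexiveTransitive using (Star)
open import Relation.Binary.Core using (Rel)
open import Relation.Binary.Definitions using (Decidable; Irreflexive; Symmetric)
open import Relation.Binary.PropositionalEquality
  using (_≡_; _≢_; refl; sym; trans; cong)
open import Relation.Nullary.Decidable using (yes; no; does; _⊎-dec_)
open import Relation.Nullary.Negation using (¬_)
open import Relation.Unary using (Pred)

-- Simple undirected graphs.  Finite graphs are those of type Graph (Fin n);
-- the vertex type is left general so that G − S can again be a graph.
record Graph (V : Set) : Set₁ where
  field
    Adj        : Rel V 0ℓ
    adj?       : Decidable Adj
    adj-sym    : Symmetric Adj
    adj-irrefl : Irreflexive _≡_ Adj

open Graph

private
  variable
    V W : Set
    n   : ℕ

record _≅_ (G : Graph V) (H : Graph W) : Set where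
  field
    bijection : V ↔ W
    preserves : ∀ u v → Adj G u v ⇔ Adj H (Inverse.to bijection u) (Inverse.to bijection v)

-- H is isomorphic to a (not necessarily induced) subgraph of G.
record _⊑_ (H : Graph W) (G : Graph V) : Set where
  field
    embed     : W → V
    injective : Injective _≡_ _≡_ embed
    preserves : ∀ u v → Adj H u v → Adj G (embed u) (embed v)

-- H is isomorphic to an induced subgraph of G.
record _⊑ᵢ_ (H : Graph W) (G : Graph V) : Set where
  field
    embed     : W → V
    injective : Injective _≡_ _≡_ embed
    preserves : ∀ u v → Adj H u v ⇔ Adj G (embed u) (embed v)

K : (m n : ℕ) → Graph (Fin m ⊎ Fin n)
K m n = record
  { Adj        = BAdj
  ; adj?       = badj?
  ; adj-sym    = λ {x} {y} → bsym x y
  ; adj-irrefl = λ { {inj₁ _} refl () ; {inj₂ _} refl () }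
  }
  where
  BAdj : Rel (Fin m ⊎ Fin n) 0ℓ
  BAdj (inj₁ _) (inj₁ _) = ⊥
  BAdj (inj₁ _) (inj₂ _) = ⊤
  BAdj (inj₂ _) (inj₁ _) = ⊤
  BAdj (inj₂ _) (inj₂ _) = ⊥

  badj? : Decidable BAdj
  badj? (inj₁ _) (inj₁ _) = no λ ()
  badj? (inj₁ _) (inj₂ _) = yes tt
  badj? (inj₂ _) (inj₁ _) = yes tt
  badj? (inj₂ _) (inj₂ _) = no λ ()

  bsym : ∀ x y → BAdj x y → BAdj y x
  bsym (inj₁ _) (inj₂ _) _ = tt
  bsym (inj₂ _) (inj₁ _) _ = tt

-- The cycle C₃₊ₘ on 0, 1, …, m + 2, with i adjacent to i ± 1 modulo m + 3.
-- The index is shifted so that exactly the lengths ≥ 3 occur.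
C₃₊ : (m : ℕ) → Graph (Fin (3 + m))
C₃₊ m = record
  { Adj        = λ i j → Next i j ⊎ Next j i
  ; adj?       = λ i j → next? i j ⊎-dec next? j i
  ; adj-sym    = swap
  ; adj-irrefl = λ { {i} refl → [ next-irrefl i , next-irrefl i ] }
  }
  where
  Next : Rel (Fin (3 + m)) 0ℓ
  Next i j = toℕ j ≡ suc (toℕ i) % (3 + m)

  next? : Decidable Next
  next? i j = toℕ j ≟ suc (toℕ i) % (3 + m)

  lemma : ∀ k → k < 3 + m → k ≢ suc k % (3 + m)
  lemma k k<3+m eq with m≤n⇒m<n∨m≡n k<3+m
  ... | inj₁ 1+k<3+m = 1+n≢n (sym (trans eq (m<n⇒m%n≡m 1+k<3+m)))
  ... | inj₂ refl with () ← trans eq (n%n≡0 (3 + m))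

  next-irrefl : ∀ i → ¬ Next i i
  next-irrefl i = lemma (toℕ i) (toℕ<n i)

_−_ : Graph V → (S : Pred V 0ℓ) → Graph [ v ∈ V ∣ ¬ S v ]
G − S = record
  { Adj        = Adj G on value
  ; adj?       = λ u v → adj? G (value u) (value v)
  ; adj-sym    = adj-sym G
  ; adj-irrefl = λ u≡v → adj-irrefl G (cong value u≡v)
  }

Connected : Graph V → Set
Connected G = ∀ u v → Star (Adj G) u v

ClawFree : Graph V → Set
ClawFree G = ¬ (K 1 3 ⊑ᵢ G)

Acyclic : Graph V → Set
Acyclic G = ∀ m → ¬ (C₃₊ m ⊑ G)

neighbours : Graph (Fin n) → Fin n → Subset n
neighbours G v = tabulate (does ∘ adj? G v)

degree : Graph (Fin n) → Fin n → ℕ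
degree G v = ∣ neighbours G v ∣

-- Maximum degree (0 if there are no vertices).
Δ : Graph (Fin n) → ℕ
Δ {n} G = max 0 (map (degree G) (allFin n))

N[_] : Subset n → Graph (Fin n) → Pred (Fin n) 0ℓ
N[ D ] G v = v ∈ D ⊎ ∃[ u ] (u ∈ D × Adj G v u)

CycleIsolating : Graph (Fin n) → Subset n → Set
CycleIsolating G D = Acyclic (G − N[ D ] G)

-- Parts may be empty.
record IsPartition {k : ℕ} (P : Fin k → Subset n) : Set where
  field
    disjoint : ∀ {i j} → i ≢ j → Empty (P i ∩ P j)
    covers   : ∀ v → ∃[ i ] v ∈ P i

{-# OPTIONS --safe #-}

-- Colour each vertex by its depth modulo 4 in a depth-first search tree, whose
-- edges in G join ancestors to descendants.  A cycle C is hit by N[D] for a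
-- colour class D as soon as N[C] contains four vertices of consecutive depths
-- on a branch.  If the shallowest vertex x of C is not the root, then its parent
-- p, x, a child w of x on C, and a child of w are such vertices.
--
-- It remains to choose the root r, and the first four vertices r, w, v, u of the
-- search, so that cycles through r are fine as well.  A vertex of degree at most
-- one lies on no cycle.  One of the two middle vertices of a diamond is adjacent
-- to the other three vertices.  Starting at a vertex of degree two or, if that
-- vertex lies in a triangle, at a neighbour of it, one finds w, v, u such that
-- N[C] contains r, w, v, u for each cycle C through r.  Otherwise G is cubic and
-- each vertex lies in exactly one triangle; start with a triangle a, b, c and
-- the outer neighbour c′ of c.  A cycle through a whose closed neighbourhood
-- misses a colour avoids c and passes through b and its outer neighbour b′, and
-- its part below c is impossible unless b′ is adjacent to the outer neighbour a′
-- of a, which a relabelling of the triangle avoids.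
module Submission where

open import Defs
open import Data.Empty using (⊥; ⊥-elim; ⊥-elim-irr)
open import Data.Fin.Base using (Fin; zero; suc; toℕ; fromℕ; fromℕ<; inject₁)
import Data.Fin.Properties as Fin
open import Data.Fin.Subset using (Subset; _∈_; ∣_∣; _-_; _∩_; Empty) renaming (⊤ to full)
open import Data.Fin.Subset.Properties
  using (∈⊤; x∈p⇒∣p-x∣<∣p∣; x∈p∧x≢y⇒x∈p-y; x∈p∩q⁻)
open import Data.Irrelevant using ([_])
open import Data.List.Base using (List; []; _∷_; length)
open import Data.List.Extrema.Nat using (xs≤max)
open import Data.List.Membership.Propositional using () renaming (_∈_ to _∈ˡ_; _∉_ to _∉ˡ_)
open import Data.List.Membership.Propositional.Properties using (∈-map⁺; ∈-allFin)
open import Data.List.Properties using (∷-injectiveˡ; ∷-injectiveʳ)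
open import Data.List.Relation.Unary.All using () renaming (lookup to lookupAll)
open import Data.List.Relation.Unary.Any using (here; there)
open import Data.List.Relation.Unary.Linked using (Linked; [-]; _∷_)
open import Data.Nat.Base using (ℕ; zero; suc; _≤_; _<_; z≤n; s≤s; _+_; _%_)
open import Data.Nat.DivMod using (m%n<n; m<n⇒m%n≡m; n%n≡0)
open import Data.Nat.Induction using (Acc; acc; <-wellFounded)
open import Data.Nat.Properties
  using (≤-refl; ≤-trans; ≤-reflexive; <-irrefl; <-trans; <-≤-trans; <⇒≤; <⇒≱;
         m≤n⇒m<n∨m≡n; m≢1+n+m)
open import Data.Product.Base using (_×_; _,_; ∃-syntax; Σ-syntax; proj₁; proj₂)
open import Data.Refinement using (value; proof)
open import Data.Refinement.Properties using (value-injective)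
open import Data.Sum.Base using (_⊎_; inj₁; inj₂; swap)
open import Data.Unit.Base using (tt)
open import Data.Vec.Base using (tabulate) renaming ([] to []ᵥ)
open import Data.Vec.Properties using (lookup∘tabulate; lookup⇒[]=; []=⇒lookup)
open import Function.Base using (_∘_; flip; case_of_)
open import Function.Bundles using (_⇔_; mk⇔; mk↔ₛ′)
open import Level using (0ℓ)
open import Relation.Binary.Construct.Closure.ReflexiveTransitive using (Star; ε; _◅_; _◅◅_)
open import Relation.Binary.Core using (Rel)
open import Relation.Binary.PropositionalEquality
  using (_≡_; _≢_; refl; sym; trans; cong; subst; ≢-sym)
open import Relation.Nullary.Decidable
  using (Dec; yes; no; does; _×-dec_; _⊎-dec_; ¬?; from-yes; decidable-stable; dec-true)
open import Relation.Nullary.Negation using (¬_; contradiction)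
open import Relation.Unary using (Pred; Decidable)

open Graph

-- Normal spanning trees

-- The tree spans: by `parent` and `⋖-depth`, passing to parents lowers the depth until r is
-- reached. Normality is the field `comparable`.
record NormalTree {n} (G : Graph (Fin n)) (r : Fin n) : Set₁ where
  infix 4 _⋖_ _≼_
  field
    _⋖_        : Rel (Fin n) 0ℓ
    depth      : Fin n → ℕ
    ⋖-adj      : ∀ {p v} → p ⋖ v → Adj G p v
    ⋖-depth    : ∀ {p v} → p ⋖ v → depth v ≡ suc (depth p)
    ⋖-unique   : ∀ {p q v} → p ⋖ v → q ⋖ v → p ≡ q
    parent     : ∀ v → v ≡ r ⊎ ∃[ p ] p ⋖ v
    root-top   : ∀ {p} → ¬ (p ⋖ r)

  _≼_ : Rel (Fin n) 0ℓ
  _≼_ = Star _⋖_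

  field
    comparable : ∀ {u v} → Adj G u v → u ≼ v ⊎ v ≼ u

-- Listed backwards, from the last vertex to r, like the stack of the search.
data Path {n} (G : Graph (Fin n)) (r : Fin n) : List (Fin n) → Set where
  [_]    : ∀ v → v ≡ r → Path G r (v ∷ [])
  extend : ∀ {v s} y → Path G r (v ∷ s) → Adj G v y → y ∉ˡ v ∷ s → Path G r (y ∷ v ∷ s)

-- Depth-first search with a prescribed initial path

module DepthFirstSearch {n} (G : Graph (Fin n)) (r : Fin n) where

  private
    V = Fin n

  data Rooted (anc : V → List V) : V → Set where
    root  : anc r ≡ r ∷ [] → Rooted anc r
    child : ∀ {p v} → Adj G p v → anc p ≢ [] → anc v ≡ v ∷ anc p → Rooted anc v

  -- anc v lists the ancestors of v, from v up to r; it is empty while v is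
  -- unvisited.  All unvisited vertices lie in U, and s is the stack.
  record State (U : Subset n) (s : List V) : Set where
    field
      anc    : V → List V
      rooted : ∀ v → anc v ≢ [] → Rooted anc v
      comp   : ∀ {u v} → Adj G u v → anc u ≢ [] → anc v ≢ [] → u ∈ˡ anc v ⊎ v ∈ˡ anc u
      done   : ∀ {u v} → Adj G u v → anc u ≢ [] → u ∈ˡ s ⊎ anc v ≢ []
      fresh  : ∀ v → anc v ≡ [] → v ∈ U
      top    : ∀ {v t} → s ≡ v ∷ t → anc v ≡ s

  open State

  empty? : (l : List V) → Dec (l ≡ [])
  empty? []      = yes refl
  empty? (_ ∷ _) = no λ ()

  ∷≢[] : ∀ {l t : List V} {v} → l ≡ v ∷ t → l ≢ []
  ∷≢[] refl ()

  anc-head : ∀ {f v w t} → Rooted f v → f v ≡ w ∷ t → v ≡ w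
  anc-head (root e)      e′ = ∷-injectiveˡ (trans (sym e) e′)
  anc-head (child _ _ e) e′ = ∷-injectiveˡ (trans (sym e) e′)

  -- The list of a vertex other than the root continues with the list of its parent. This restores
  -- `top` after a pop and reads a branch off the list of its last vertex.
  anc-tail : ∀ {f u v t} → (∀ w → f w ≢ [] → Rooted f w) → f u ≡ u ∷ v ∷ t →
             f v ≡ v ∷ t × Adj G v u
  anc-tail {f} rt e with rt _ (∷≢[] e)
  ... | root e′ with () ← trans (sym e) e′
  ... | child {p} pv p≢[] e′ with ∷-injectiveʳ (trans (sym e′) e)
  ...   | e″ with anc-head (rt p p≢[]) e″
  ...     | refl = e″ , pv

  update : (V → List V) → V → List V → V → List V
  update f y l v with v Fin.≟ y
  ... | yes _ = l
  ... | no  _ = f v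

  update-≡ : ∀ f y l → update f y l y ≡ l
  update-≡ f y l with y Fin.≟ y
  ... | yes _   = refl
  ... | no y≢y = contradiction refl y≢y

  update-≢ : ∀ f y l {v} → v ≢ y → update f y l v ≡ f v
  update-≢ f y l {v} v≢y with v Fin.≟ y
  ... | yes v≡y = contradiction v≡y v≢y
  ... | no _    = refl

  start : State full (r ∷ [])
  start = record
    { anc    = f
    ; rooted = rt
    ; comp   = λ {u} {v} uv u≢ v≢ → inj₁ (subst (λ x → x ∈ˡ f v) (trans (only v v≢) (sym (only u u≢)))
                 (subst (v ∈ˡ_) (sym (trans (cong f (only v v≢)) eq)) (here (only v v≢))))
    ; done   = λ {u} _ u≢ → inj₁ (here (only u u≢))
    ; fresh  = λ _ _ → ∈⊤
    ; top    = λ { refl → eq }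
    }
    where
    f : V → List V
    f = update (λ _ → []) r (r ∷ [])
    eq : f r ≡ r ∷ []
    eq = update-≡ (λ _ → []) r (r ∷ [])
    only : ∀ v → f v ≢ [] → v ≡ r
    only v v≢ with v Fin.≟ r
    ... | yes v≡r = v≡r
    ... | no  _   = contradiction refl v≢
    rt : ∀ v → f v ≢ [] → Rooted f v
    rt v v≢ with only v v≢
    ... | refl = root eq

  push : ∀ {U v s} (σ : State U (v ∷ s)) y → Adj G v y → anc σ y ≡ [] →
         Σ[ σ′ ∈ State (U - y) (y ∷ v ∷ s) ]
           (anc σ′ y ≡ y ∷ v ∷ s × (∀ w → w ≢ y → anc σ′ w ≡ anc σ w))
  push {U} {v} {s} σ y vy y-new = σ′ , at-y , λ w → at-≢
    where
    f : V → List V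
    f = update (anc σ) y (y ∷ v ∷ s)
    at-y : f y ≡ y ∷ v ∷ s
    at-y = update-≡ (anc σ) y _
    at-≢ : ∀ {w} → w ≢ y → f w ≡ anc σ w
    at-≢ = update-≢ (anc σ) y _
    old : ∀ {w} → anc σ w ≢ [] → w ≢ y
    old w≢[] refl = w≢[] y-new
    keep : ∀ {w} → anc σ w ≢ [] → f w ≢ []
    keep w≢[] = w≢[] ∘ trans (sym (at-≢ (old w≢[])))
    v-old : anc σ v ≢ []
    v-old = ∷≢[] (top σ refl)
    lift : ∀ {w} → Rooted (anc σ) w → w ≢ y → Rooted f w
    lift (root e)        w≢y = root (trans (at-≢ w≢y) e)
    lift (child pw p≢ e) w≢y =
      child pw (keep p≢) (trans (at-≢ w≢y) (trans e (cong (_ ∷_) (sym (at-≢ (old p≢))))))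
    rt : ∀ w → f w ≢ [] → Rooted f w
    rt w w≢[] with w Fin.≟ y
    ... | yes refl = child vy (keep v-old)
            (trans at-y (cong (y ∷_) (sym (trans (at-≢ (old v-old)) (top σ refl)))))
    ... | no w≢y = lift (rooted σ w w≢[]) w≢y
    -- A visited vertex that has left the stack has only visited neighbours, and y is new, so w is
    -- still on the stack and becomes an ancestor of y.
    on-stack : ∀ {w} → Adj G w y → anc σ w ≢ [] → w ∈ˡ f y
    on-stack wy w≢[] with done σ wy w≢[]
    ... | inj₁ w∈s = subst (_ ∈ˡ_) (sym at-y) (there w∈s)
    ... | inj₂ y≢  = contradiction y-new y≢
    cmp : ∀ {u w} → Adj G u w → f u ≢ [] → f w ≢ [] → u ∈ˡ f w ⊎ w ∈ˡ f u
    cmp {u} {w} uw u≢[] w≢[] with u Fin.≟ y | w Fin.≟ y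
    ... | yes refl | yes refl = contradiction uw (adj-irrefl G refl)
    ... | yes refl | no w≢y   = inj₂ (subst (w ∈ˡ_) at-y (on-stack (adj-sym G uw) w≢[]))
    ... | no u≢y   | yes refl = inj₁ (subst (u ∈ˡ_) at-y (on-stack uw u≢[]))
    ... | no u≢y   | no w≢y   = comp σ uw u≢[] w≢[]
    dn : ∀ {u w} → Adj G u w → f u ≢ [] → u ∈ˡ y ∷ v ∷ s ⊎ f w ≢ []
    dn {u} {w} uw u≢[] with u Fin.≟ y
    ... | yes u≡y = inj₁ (here u≡y)
    ... | no _ with done σ uw u≢[]
    ...   | inj₁ u∈s = inj₁ (there u∈s)
    ...   | inj₂ w≢  = inj₂ (keep w≢)
    fr : ∀ w → f w ≡ [] → w ∈ U - y
    fr w w≡[] = x∈p∧x≢y⇒x∈p-y (fresh σ w (trans (sym (at-≢ w≢y)) w≡[])) w≢y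
      where
      w≢y : w ≢ y
      w≢y refl with () ← trans (sym at-y) w≡[]
    σ′ : State (U - y) (y ∷ v ∷ s)
    σ′ = record { anc = f ; rooted = rt ; comp = cmp ; done = dn ; fresh = fr
                ; top = λ { refl → at-y } }

  pop : ∀ {U v s} (σ : State U (v ∷ s)) → (∀ y → Adj G v y → anc σ y ≢ []) →
        Σ[ σ′ ∈ State U s ] (∀ w → anc σ′ w ≡ anc σ w)
  pop {U} {v} {s} σ closed = σ′ , λ _ → refl
    where
    dn : ∀ {u w} → Adj G u w → anc σ u ≢ [] → u ∈ˡ s ⊎ anc σ w ≢ []
    dn uw u≢[] with done σ uw u≢[]
    ... | inj₁ (here refl) = inj₂ (closed _ uw)
    ... | inj₁ (there u∈s) = inj₁ u∈s
    ... | inj₂ w≢          = inj₂ w≢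
    σ′ : State U s
    σ′ = record { anc = anc σ ; rooted = rooted σ ; comp = comp σ ; done = dn ; fresh = fresh σ
                ; top = λ { refl → let e , _ = anc-tail (rooted σ) (top σ refl) in e } }

  -- Vertices off the path stay unvisited, which is what the next push requires.
  start-path : ∀ {v s} → Path G r (v ∷ s) →
               ∃[ U ] Σ[ σ ∈ State U (v ∷ s) ] (∀ w → w ∉ˡ v ∷ s → anc σ w ≡ [])
  start-path ([ v ] refl) = full , start , λ w w∉ → update-≢ (λ _ → []) v _ (w∉ ∘ here)
  start-path (extend y path vy y∉) =
    let U , σ , new      = start-path path
        σ′ , _ , same = push σ y vy (new y y∉)
    in  U - y , σ′ , λ w w∉ → trans (same w (w∉ ∘ here)) (new w (w∉ ∘ there))

  -- Termination is lexicographic: a push shrinks U, and a pop keeps U but shortens the stack. The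
  -- list of u never changes once it is set.
  run : ∀ {U u l} → Acc _<_ ∣ U ∣ → ∀ s (σ : State U s) → anc σ u ≡ u ∷ l →
        ∃[ U′ ] Σ[ σ′ ∈ State U′ [] ] anc σ′ u ≡ u ∷ l
  run {U} {u} {l} (acc rs) = go
    where
    go : ∀ s (σ : State U s) → anc σ u ≡ u ∷ l →
         ∃[ U′ ] Σ[ σ′ ∈ State U′ [] ] anc σ′ u ≡ u ∷ l
    go []      σ eq = _ , σ , eq
    go (v ∷ s) σ eq with Fin.any? (λ y → adj? G v y ×-dec empty? (anc σ y))
    ... | yes (y , vy , y-new) =
      let σ′ , _ , same = push σ y vy y-new
      in  run (rs (x∈p⇒∣p-x∣<∣p∣ (fresh σ y y-new))) (y ∷ v ∷ s) σ′
            (trans (same _ λ { refl → ∷≢[] eq y-new }) eq)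
    ... | no ¬∃ =
      let σ′ , same = pop σ (λ y vy y-new → ¬∃ (y , vy , y-new))
      in  go s σ′ (trans (same _) eq)

  module Tree (conn : Connected G) (f : V → List V) (rt : ∀ v → f v ≢ [] → Rooted f v)
              (cmp : ∀ {u v} → Adj G u v → f u ≢ [] → f v ≢ [] → u ∈ˡ f v ⊎ v ∈ˡ f u)
              (closed : ∀ {u v} → Adj G u v → f u ≢ [] → f v ≢ [])
              {u₀ l} (path : Path G r (u₀ ∷ l)) (f-u₀ : f u₀ ≡ u₀ ∷ l) where

    visited : ∀ v → f v ≢ []
    visited v = go (conn u₀ v) (∷≢[] f-u₀)
      where
      go : ∀ {u v} → Star (Adj G) u v → f u ≢ [] → f v ≢ []
      go ε         u≢ = u≢
      go (uw ◅ wv) u≢ = go wv (closed uw u≢)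

    _◁_ : Rel V 0ℓ
    p ◁ v = Adj G p v × f v ≡ v ∷ f p

    ancestor : ∀ {u v} l → f v ≡ l → u ∈ˡ l → Star _◁_ u v
    ancestor {v = v} l@(_ ∷ t) e (here refl) with anc-head (rt v (visited v)) e
    ... | refl = ε
    ancestor {v = v} (w ∷ t) e (there u∈) with rt v (visited v)
    ... | root e′ with refl ← trans (sym e) e′ with () ← u∈
    ... | child {p} pv _ e′ =
      ancestor t (∷-injectiveʳ (trans (sym e′) e)) u∈ ◅◅ ((pv , e′) ◅ ε)

    unique : ∀ {p q v} → p ◁ v → q ◁ v → p ≡ q
    unique {p} {q} (_ , e) (_ , e′) with f p in fp
    ... | []    = contradiction fp (visited p)
    ... | _ ∷ _ = trans (anc-head (rt p (visited p)) fp)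
                        (sym (anc-head (rt q (visited q)) (∷-injectiveʳ (trans (sym e′) e))))

    par : ∀ v → v ≡ r ⊎ ∃[ p ] p ◁ v
    par v with rt v (visited v)
    ... | root _        = inj₁ refl
    ... | child pv _ e = inj₂ (_ , pv , e)

    branch : ∀ {v s} → Path G r (v ∷ s) → f v ≡ v ∷ s → Linked (flip _◁_) (v ∷ s)
    branch ([ v ] _)         e = [-]
    branch (extend _ p uv _) e =
      let e′ , _ = anc-tail rt e in (uv , trans e (cong (_ ∷_) (sym e′))) ∷ branch p e′

    f-r : ∀ {v s} → Path G r (v ∷ s) → f v ≡ v ∷ s → f r ≡ r ∷ []
    f-r ([ v ] refl)     e = e
    f-r (extend _ p _ _) e = let e′ , _ = anc-tail rt e in f-r p e′

    r-top : ∀ {p} → ¬ (p ◁ r)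
    r-top {p} (_ , e) = visited p (∷-injectiveʳ (trans (sym e) (f-r path f-u₀)))

    comparable : ∀ {u v} → Adj G u v → Star _◁_ u v ⊎ Star _◁_ v u
    comparable uv with cmp uv (visited _) (visited _)
    ... | inj₁ u∈ = inj₁ (ancestor _ refl u∈)
    ... | inj₂ v∈ = inj₂ (ancestor _ refl v∈)

    tree : NormalTree G r
    tree = record
      { _⋖_ = _◁_ ; depth = length ∘ f ; ⋖-adj = λ (pv , _) → pv
      ; ⋖-depth = λ (_ , e) → cong length e ; ⋖-unique = unique ; parent = par
      ; root-top = r-top ; comparable = comparable }

-- The path is pushed before the search runs, so it becomes the start of a branch; each case below
-- can thus prescribe the first vertices of the tree.
normalTree : ∀ {n} {G : Graph (Fin n)} {r v s} → Connected G → Path G r (v ∷ s) →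
             Σ[ T ∈ NormalTree G r ] Linked (flip (NormalTree._⋖_ T)) (v ∷ s)
normalTree {G = G} {r} conn path =
  let U , σ , _    = start-path path
      _ , σ′ , eq = run (<-wellFounded _) _ σ (State.top σ refl)
      module T = Tree conn (State.anc σ′) (State.rooted σ′) (State.comp σ′)
                   (λ uv u≢ → closed σ′ uv u≢) path eq
  in  T.tree , T.branch path eq
  where
  open DepthFirstSearch G r
  -- With an empty stack, `done` leaves only the alternative that the neighbour is visited.
  closed : ∀ {U} (σ : State U []) {u v} → Adj G u v → State.anc σ u ≢ [] → State.anc σ v ≢ []
  closed σ uv u≢ with State.done σ uv u≢
  ... | inj₂ v≢ = v≢

-- Colouring by depth modulo four

next : Fin 4 → Fin 4
next zero                   = suc zero
next (suc zero)             = suc (suc zero)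
next (suc (suc zero))       = suc (suc (suc zero))
next (suc (suc (suc zero))) = zero

colour : ℕ → Fin 4
colour zero    = zero
colour (suc d) = next (colour d)

four-in-a-row : ∀ c k → k ≡ c ⊎ k ≡ next c ⊎ k ≡ next (next c) ⊎ k ≡ next (next (next c))
four-in-a-row = from-yes (Fin.all? λ c → Fin.all? λ k →
  k Fin.≟ c ⊎-dec k Fin.≟ next c ⊎-dec k Fin.≟ next (next c) ⊎-dec k Fin.≟ next (next (next c)))

-- Cycles that avoid a colour class

module _ {n} (G : Graph (Fin n)) where

  private
    V = Fin n

  Subcubic : Set
  Subcubic = ∀ {v x y z u} → Adj G v x → Adj G v y → Adj G v z → x ≢ y → x ≢ z → y ≢ z →
             Adj G v u → u ≡ x ⊎ u ≡ y ⊎ u ≡ z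

  -- The only property of the vertex set of a cycle that is needed.
  Cyclic : (V → Set) → Set
  Cyclic S = ∀ {x} → S x → ∃[ y ] ∃[ z ] (y ≢ z × (Adj G x y × S y) × (Adj G x z × S z))

  Seen : (V → Set) → V → Set
  Seen S v = S v ⊎ ∃[ u ] (S u × Adj G u v)

  -- S stands for the vertex set of a cycle in G - N[D], where D is the class of colour k: the
  -- closed neighbourhood of S contains no vertex of that colour.
  record Avoids {r} (T : NormalTree G r) (k : Fin 4) (S : V → Set) : Set where
    field
      cyclic : Cyclic S
      unseen : ∀ {v} → Seen S v → k ≢ colour (NormalTree.depth T v)

  -- Cycles through the root are treated apart, because the root has no parent to complete four
  -- consecutive depths.
  GoodRoot : ∀ {r} → NormalTree G r → Set₁
  GoodRoot {r} T = ∀ {k S} → Avoids T k S → ¬ S r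

  NoClaw : Set
  NoClaw = ∀ {v x y z} → Adj G v x → Adj G v y → Adj G v z → x ≢ y → x ≢ z → y ≢ z →
              Adj G x y ⊎ Adj G x z ⊎ Adj G y z

  -- No edge lies in two triangles.
  DiamondFree : Set
  DiamondFree = ∀ {s t p q} → Adj G s t → Adj G s p → Adj G t p → Adj G s q → Adj G t q → p ≡ q

  -- No two vertices exhaust a neighbourhood; p and q may coincide and may be any vertices.
  MinDegree3 : Set
  MinDegree3 = ∀ v p q → ∃[ x ] (Adj G v x × x ≢ p × x ≢ q)

  Adj⇒≢ : ∀ {u v} → Adj G u v → u ≢ v
  Adj⇒≢ uv refl = adj-irrefl G refl uv

  cyclic-≢ : ∀ {S} → Cyclic S → ∀ {x} → S x → ∀ q → ∃[ y ] (y ≢ q × Adj G x y × S y)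
  cyclic-≢ cyc Sx q with cyc Sx
  ... | y , z , y≢z , (xy , Sy) , (xz , Sz) with y Fin.≟ q
  ...   | no y≢q   = y , y≢q , xy , Sy
  ...   | yes refl = z , ≢-sym y≢z , xz , Sz

  forced : ∀ {S} → Cyclic S → ∀ {v p q} → (∀ {x} → Adj G v x → x ≡ p ⊎ x ≡ q) → S v → S p
  forced cyc {q = q} only Sv with cyclic-≢ cyc Sv q
  ... | y , y≢q , vy , Sy with only vy
  ...   | inj₁ refl = Sy
  ...   | inj₂ y≡q  = contradiction y≡q y≢q

  module TreeProperties {r} (T : NormalTree G r) where
    open NormalTree T public

    last-step : ∀ {u v} → u ≼ v → u ≡ v ⊎ ∃[ p ] (u ≼ p × p ⋖ v)
    last-step ε = inj₁ refl
    last-step (uw ◅ w≼v) with last-step w≼v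
    ... | inj₁ refl            = inj₂ (_ , ε , uw)
    ... | inj₂ (p , w≼p , pv) = inj₂ (p , uw ◅ w≼p , pv)

    ancestor-of-parent : ∀ {u p v} → p ⋖ v → u ≼ v → u ≢ v → u ≼ p
    ancestor-of-parent pv u≼v u≢v with last-step u≼v
    ... | inj₁ u≡v = contradiction u≡v u≢v
    ... | inj₂ (q , u≼q , qv) with refl ← ⋖-unique pv qv = u≼q

    ancestor-of-root : ∀ {u} → u ≼ r → u ≡ r
    ancestor-of-root u≼r with last-step u≼r
    ... | inj₁ u≡r           = u≡r
    ... | inj₂ (_ , _ , pr) = contradiction pr root-top

    ⋖-depth-< : ∀ {p v} → p ⋖ v → depth p < depth v
    ⋖-depth-< pv = ≤-reflexive (sym (⋖-depth pv))

    ≼-depth : ∀ {u v} → u ≼ v → depth u ≤ depth v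
    ≼-depth ε           = ≤-refl
    ≼-depth (uw ◅ w≼v) = ≤-trans (<⇒≤ (⋖-depth-< uw)) (≼-depth w≼v)

    ≺-depth : ∀ {u v} → u ≼ v → u ≢ v → depth u < depth v
    ≺-depth ε           u≢v = contradiction refl u≢v
    ≺-depth (uw ◅ w≼v) _   = <-≤-trans (⋖-depth-< uw) (≼-depth w≼v)

    ancestors-linear : ∀ {u v w} → u ≼ w → v ≼ w → u ≼ v ⊎ v ≼ u
    ancestors-linear ε           v≼w = inj₂ v≼w
    ancestors-linear (uk ◅ k≼w) v≼w with ancestors-linear k≼w v≼w
    ... | inj₁ k≼v = inj₁ (uk ◅ k≼v)
    ... | inj₂ v≼k with last-step v≼k
    ...   | inj₁ refl = inj₁ (uk ◅ ε)
    ...   | inj₂ (p , v≼p , pk) with refl ← ⋖-unique uk pk = inj₂ v≼p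

    module Avoidance {k S} (av : Avoids T k S) where
      open Avoids av public

      -- Four consecutive depths carry all four colours, so one of these vertices has colour k.
      window : ∀ {p x w v} → p ⋖ x → x ⋖ w → w ⋖ v →
               Seen S p → Seen S x → Seen S w → Seen S v → ⊥
      window {p} {x} {w} {v} px xw wv sp sx sw sv with four-in-a-row (colour (depth p)) k
      ... | inj₁ e = unseen sp e
      ... | inj₂ (inj₁ e) = unseen sx (trans e (cong colour (sym (⋖-depth px))))
      ... | inj₂ (inj₂ (inj₁ e)) = unseen sw (trans e
              (cong colour (sym (trans (⋖-depth xw) (cong suc (⋖-depth px))))))
      ... | inj₂ (inj₂ (inj₂ e)) = unseen sv (trans e
              (cong colour (sym (trans (⋖-depth wv)
                (cong suc (trans (⋖-depth xw) (cong suc (⋖-depth px))))))))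

      -- A shallowest vertex x of S has its parent p outside S, so a child w of
      -- x lies in S; w in turn has a child v, and p, x, w, v show all colours.
      empty : Subcubic → ¬ S r → ∀ x → ¬ S x
      empty subcubic ¬Sr x = go x (<-wellFounded _)
        where
        go : ∀ x → Acc _<_ (depth x) → ¬ S x
        go x (acc rs) Sx with parent x
        ... | inj₁ refl = ¬Sr Sx
        ... | inj₂ (p , px) with cyclic Sx
        ...   | y , z , y≢z , (xy , Sy) , (xz , Sz) = finish (below Sy xy)
          where
          not-above : ∀ {u} → S u → u ≼ x → u ≡ x
          not-above {u} Su u≼x = decidable-stable (u Fin.≟ x) λ u≢x →
            go u (rs (≺-depth u≼x u≢x)) Su
          below : ∀ {u} → S u → Adj G x u → x ≼ u
          below Su xu with comparable xu
          ... | inj₁ x≼u = x≼u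
          ... | inj₂ u≼x = contradiction (sym (not-above Su u≼x)) (Adj⇒≢ xu)
          p≢ : ∀ {u} → S u → p ≢ u
          p≢ Su refl = go p (rs (⋖-depth-< px)) Su
          -- The neighbours of x are p, y and z, and p lies above x.
          child-in-S : ∀ {w} → x ⋖ w → S w
          child-in-S {w} xw
            with subcubic (adj-sym G (⋖-adj px)) xy xz (p≢ Sy) (p≢ Sz) y≢z (⋖-adj xw)
          ... | inj₁ refl = ⊥-elim (<-irrefl refl (<-trans (⋖-depth-< px) (⋖-depth-< xw)))
          ... | inj₂ (inj₁ refl) = Sy
          ... | inj₂ (inj₂ refl) = Sz
          grandchild : ∀ {w v} → x ⋖ w → S w → w ⋖ v → ⊥
          grandchild xw Sw wv = window px xw wv (inj₂ (x , Sx , adj-sym G (⋖-adj px)))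
            (inj₁ Sx) (inj₁ Sw) (inj₂ (_ , Sw , ⋖-adj wv))
          finish : x ≼ y → ⊥
          finish ε = Adj⇒≢ xy refl
          finish (_◅_ {j = w} xw _) with cyclic-≢ cyclic (child-in-S xw) x
          ... | t , t≢x , wt , St with comparable wt
          ...   | inj₁ ε          = Adj⇒≢ wt refl
          ...   | inj₁ (wv ◅ _)   = grandchild xw (child-in-S xw) wv
          -- An ancestor of w other than w is an ancestor of x; lying in S, it can only be x.
          ...   | inj₂ t≼w = t≢x (not-above St
                    (ancestor-of-parent xw t≼w (≢-sym (Adj⇒≢ wt))))

-- A triangle at the root of a cubic diamond-free graph

record Triangle {n} (G : Graph (Fin n)) (a b c a′ b′ c′ : Fin n) : Set where
  field
    ab  : Adj G a b
    ac  : Adj G a c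
    bc  : Adj G b c
    aa′ : Adj G a a′
    bb′ : Adj G b b′
    cc′ : Adj G c c′
    a′≢b : a′ ≢ b
    a′≢c : a′ ≢ c
    b′≢a : b′ ≢ a
    b′≢c : b′ ≢ c
    c′≢a : c′ ≢ a
    c′≢b : c′ ≢ b

module _ {n} {G : Graph (Fin n)} (subcubic : Subcubic G) (claw-free : NoClaw G)
         (diamond-free : DiamondFree G) (degree-3 : MinDegree3 G) where

  -- The condition `a′b′⇒b′c′` ensures that, whenever a′ and b′ are adjacent, a cycle through b′
  -- sees c′.
  module TriangleRoot {a b c a′ b′ c′} (tri : Triangle G a b c a′ b′ c′)
                      (a′b′⇒b′c′ : Adj G a′ b′ → Adj G b′ c′) (T : NormalTree G a)
                      (a⋖b : NormalTree._⋖_ T a b) (b⋖c : NormalTree._⋖_ T b c)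
                      (c⋖c′ : NormalTree._⋖_ T c c′) where
    open Triangle tri
    open TreeProperties G T

    nbr-a : ∀ {u} → Adj G a u → u ≡ b ⊎ u ≡ c ⊎ u ≡ a′
    nbr-a = subcubic ab ac aa′ (Adj⇒≢ G bc) (≢-sym a′≢b) (≢-sym a′≢c)

    nbr-b : ∀ {u} → Adj G b u → u ≡ a ⊎ u ≡ c ⊎ u ≡ b′
    nbr-b = subcubic (adj-sym G ab) bc bb′ (Adj⇒≢ G ac) (≢-sym b′≢a) (≢-sym b′≢c)

    -- The region below c, into which a cycle through a and b that misses c has to continue.
    record Deep (x : Fin n) : Set where
      constructor deep
      field
        c≼x : c ≼ x
        c≢x : c ≢ x

    deep-depth : ∀ {x} → Deep x → depth c < depth x
    deep-depth (deep c≼x c≢x) = ≺-depth c≼x c≢x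

    deep-≢b : ∀ {x} → Deep x → x ≢ b
    deep-≢b d refl = <-irrefl refl (<-trans (⋖-depth-< b⋖c) (deep-depth d))

    deep-≢a : ∀ {x} → Deep x → x ≢ a
    deep-≢a d refl =
      <-irrefl refl (<-trans (⋖-depth-< a⋖b) (<-trans (⋖-depth-< b⋖c) (deep-depth d)))

    deep-child : ∀ {x w} → Deep x → x ⋖ w → Deep w
    deep-child d xw = deep (Deep.c≼x d ◅◅ (xw ◅ ε))
      λ { refl → <-irrefl refl (<-trans (deep-depth d) (⋖-depth-< xw)) }

    OneOfab : Fin n → Set
    OneOfab t = t ≡ a ⊎ t ≡ b

    deep-≢ab : ∀ {x} → Deep x → ¬ OneOfab x
    deep-≢ab d (inj₁ e) = deep-≢a d e
    deep-≢ab d (inj₂ e) = deep-≢b d e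

    outer : ∀ {x t} → Deep x → OneOfab t → Adj G x t → x ≡ a′ ⊎ x ≡ b′
    outer d (inj₁ refl) xa with nbr-a (adj-sym G xa)
    ... | inj₁ e        = contradiction e (deep-≢b d)
    ... | inj₂ (inj₁ e) = contradiction (sym e) (Deep.c≢x d)
    ... | inj₂ (inj₂ e) = inj₁ e
    outer d (inj₂ refl) xb with nbr-b (adj-sym G xb)
    ... | inj₁ e        = contradiction e (deep-≢a d)
    ... | inj₂ (inj₁ e) = contradiction (sym e) (Deep.c≢x d)
    ... | inj₂ (inj₂ e) = inj₂ e

    -- If the common neighbour m were in the triangle a, b, c, then x would complete a diamond;
    -- otherwise m is the outer neighbour of t, which is x itself.
    no-common : ∀ {x t m} → Deep x → OneOfab t → Adj G x t → Adj G t m → ¬ Adj G x m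
    no-common d (inj₁ refl) xa am xm with nbr-a am
    ... | inj₁ refl = Deep.c≢x d (diamond-free ab ac bc (adj-sym G xa) (adj-sym G xm))
    ... | inj₂ (inj₁ refl) = deep-≢b d
            (sym (diamond-free ac ab (adj-sym G bc) (adj-sym G xa) (adj-sym G xm)))
    ... | inj₂ (inj₂ refl) with nbr-a (adj-sym G xa)
    ...   | inj₁ e           = deep-≢b d e
    ...   | inj₂ (inj₁ e)    = Deep.c≢x d (sym e)
    ...   | inj₂ (inj₂ refl) = adj-irrefl G refl xm
    no-common d (inj₂ refl) xb bm xm with nbr-b bm
    ... | inj₁ refl = Deep.c≢x d (diamond-free ab ac bc (adj-sym G xm) (adj-sym G xb))
    ... | inj₂ (inj₁ refl) = deep-≢a d
            (sym (diamond-free bc (adj-sym G ab) (adj-sym G ac) (adj-sym G xb) (adj-sym G xm)))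
    ... | inj₂ (inj₂ refl) with nbr-b (adj-sym G xb)
    ...   | inj₁ e           = deep-≢a d e
    ...   | inj₂ (inj₁ e)    = Deep.c≢x d (sym e)
    ...   | inj₂ (inj₂ refl) = adj-irrefl G refl xm

    good : GoodRoot G T
    good {k} {S} av Sa = go b′ (<-wellFounded _) b′-deep Sb′
      where
      open Avoidance av

      beside : ∀ {u v} → S u → Adj G u v → Seen G S v
      beside Su uv = inj₂ (_ , Su , uv)

      ¬Sc : ¬ S c
      ¬Sc Sc = window a⋖b b⋖c c⋖c′
        (inj₁ Sa) (beside Sa ab) (beside Sa ac) (beside Sc cc′)

      Sb : S b
      Sb with cyclic-≢ G cyclic Sa a′
      ... | y , y≢a′ , ay , Sy with nbr-a ay
      ...   | inj₁ refl        = Sy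
      ...   | inj₂ (inj₁ refl) = contradiction Sy ¬Sc
      ...   | inj₂ (inj₂ y≡a′) = contradiction y≡a′ y≢a′

      Sb′ : S b′
      Sb′ with cyclic-≢ G cyclic Sb a
      ... | y , y≢a , by , Sy with nbr-b by
      ...   | inj₁ y≡a         = contradiction y≡a y≢a
      ...   | inj₂ (inj₁ refl) = contradiction Sy ¬Sc
      ...   | inj₂ (inj₂ refl) = Sy

      ancestor-of-b : ∀ {u} → u ≼ b → OneOfab u
      ancestor-of-b {u} u≼b with u Fin.≟ b
      ... | yes u≡b = inj₂ u≡b
      ... | no  u≢b = inj₁ (ancestor-of-root (ancestor-of-parent a⋖b u≼b u≢b))

      -- A neighbour of b′ other than a and b is not an ancestor of b′, as a and b would be the only
      -- ones. So b′ would have a child, seen together with a, b and b′.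
      ¬b⋖b′ : ¬ (b ⋖ b′)
      ¬b⋖b′ bb′ with degree-3 b′ a b
      ... | x , b′x , x≢a , x≢b with comparable b′x
      ...   | inj₁ ε         = adj-irrefl G refl b′x
      ...   | inj₁ (b′q ◅ _) = window a⋖b bb′ b′q
                (inj₁ Sa) (inj₁ Sb) (inj₁ Sb′) (beside Sb′ (⋖-adj b′q))
      ...   | inj₂ x≼b′ with ancestor-of-b (ancestor-of-parent bb′ x≼b′ (≢-sym (Adj⇒≢ G b′x)))
      ...     | inj₁ x≡a = x≢a x≡a
      ...     | inj₂ x≡b = x≢b x≡b

      -- The tree path from b down to b′ starts with a child of b, which is neither a nor b′ and
      -- hence is c.
      b′-deep : Deep b′
      b′-deep with comparable bb′
      ... | inj₂ b′≼b with ancestor-of-b b′≼b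
      ...   | inj₁ e    = contradiction e b′≢a
      ...   | inj₂ refl = ⊥-elim (adj-irrefl G refl bb′)
      b′-deep | inj₁ ε = ⊥-elim (adj-irrefl G refl bb′)
      b′-deep | inj₁ (bk ◅ k≼b′) with nbr-b (⋖-adj bk)
      ... | inj₁ refl        = contradiction bk root-top
      ... | inj₂ (inj₁ refl) = deep k≼b′ (≢-sym b′≢c)
      ... | inj₂ (inj₂ refl) = contradiction bk ¬b⋖b′

      -- As in TreeProperties.Avoidance.empty, x is a shallowest vertex of S, but
      -- only among the vertices strictly below c.  A child w of x in S has to be
      -- a leaf, so it is a′ or b′, and claw-freeness at w makes w adjacent to p.
      -- Two such children form a diamond with x and p.  With only one, x is the
      -- other of a′, b′, hence a′ ~ b′ ~ c′ and S sees a, b, c, c′.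
      go : ∀ x → Acc _<_ (depth x) → Deep x → ¬ S x
      go x (acc rs) dx@(deep c≼x c≢x) Sx with last-step c≼x
      ... | inj₁ c≡x = c≢x c≡x
      ... | inj₂ (p , c≼p , px) = finish
        where
        ¬Sp : ¬ S p
        ¬Sp Sp with c Fin.≟ p
        ... | yes refl = ¬Sc Sp
        ... | no c≢p   = go p (rs (⋖-depth-< px)) (deep c≼p c≢p) Sp

        p-seen : Seen G S p
        p-seen = beside Sx (adj-sym G (⋖-adj px))

        p-≢ab : ¬ OneOfab p
        p-≢ab p∈ with c Fin.≟ p
        p-≢ab (inj₁ refl) | yes refl = adj-irrefl G refl ac
        p-≢ab (inj₂ refl) | yes refl = adj-irrefl G refl bc
        ... | no c≢p = deep-≢ab (deep c≼p c≢p) p∈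

        -- Vertices strictly between c and x are excluded by the choice of x and c by `¬Sc`, so u
        -- lies above c, where only a and b are.
        above : ∀ {u} → S u → u ≼ x → u ≢ x → OneOfab u
        above {u} Su u≼x u≢x with u Fin.≟ c | ancestors-linear u≼x c≼x
        ... | yes refl | _        = contradiction Su ¬Sc
        ... | no u≢c   | inj₁ u≼c = ancestor-of-b (ancestor-of-parent b⋖c u≼c u≢c)
        ... | no u≢c   | inj₂ c≼u =
          contradiction Su (go u (rs (≺-depth u≼x u≢x)) (deep c≼u (≢-sym u≢c)))

        below : ∀ {u} → S u → Adj G x u → x ≼ u ⊎ OneOfab u
        below Su xu with comparable xu
        ... | inj₁ x≼u = inj₁ x≼u
        ... | inj₂ u≼x = inj₂ (above Su u≼x (≢-sym (Adj⇒≢ G xu)))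

        leaf : ∀ {w v} → x ⋖ w → S w → ¬ (w ⋖ v)
        leaf xw Sw wv = window px xw wv p-seen (inj₁ Sx) (inj₁ Sw) (beside Sw (⋖-adj wv))

        above-x : ∀ {w u} → x ⋖ w → S w → Adj G w u → u ≼ x
        above-x xw Sw wu with comparable wu
        ... | inj₁ ε        = ⊥-elim (adj-irrefl G refl wu)
        ... | inj₁ (wv ◅ _) = contradiction wv (leaf xw Sw)
        ... | inj₂ u≼w      = ancestor-of-parent xw u≼w (≢-sym (Adj⇒≢ G wu))

        p≢child : ∀ {w} → x ⋖ w → p ≢ w
        p≢child xw refl = <-irrefl refl (<-trans (⋖-depth-< px) (⋖-depth-< xw))

        -- As w is a leaf, its second neighbour t in S lies above x, so t is a or b. The edge from w
        -- to t is in no triangle, so among the neighbours x, t, q of w only x and q can be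
        -- adjacent.
        child : ∀ {w} → x ⋖ w → S w → Adj G w p × (w ≡ a′ ⊎ w ≡ b′)
        child {w} xw Sw with cyclic-≢ G cyclic Sw x
        ... | t , t≢x , wt , St with above St (above-x xw Sw wt) t≢x | degree-3 w x t
        ...   | t∈ab | q , wq , q≢x , q≢t with outer dw t∈ab wt
                         | claw-free (adj-sym G (⋖-adj xw)) wt wq (≢-sym t≢x) (≢-sym q≢x) (≢-sym q≢t)
          where dw = deep-child dx xw
        ...     | w∈ | inj₁ xt = contradiction (adj-sym G (⋖-adj xw))
                         (no-common (deep-child dx xw) t∈ab wt (adj-sym G xt))
        ...     | w∈ | inj₂ (inj₂ tq) = contradiction wq (no-common (deep-child dx xw) t∈ab wt tq)
        ...     | w∈ | inj₂ (inj₁ xq) with q Fin.≟ p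
        ...       | yes refl = wq , w∈
        -- Now p, w, q are all the neighbours of x. Since p is not in S, the cycle passes through q,
        -- which then is a or b and has the neighbour w in common with x.
        ...       | no q≢p with cyclic-≢ G cyclic Sx w
        ...         | y , y≢w , xy , Sy
                      with subcubic (adj-sym G (⋖-adj px)) (⋖-adj xw) xq (p≢child xw) (≢-sym q≢p) (Adj⇒≢ G wq) xy
        ...           | inj₁ refl        = contradiction Sy ¬Sp
        ...           | inj₂ (inj₁ y≡w)  = contradiction y≡w y≢w
        ...           | inj₂ (inj₂ refl) = contradiction (⋖-adj xw)
                          (no-common dx (above Sy (above-x xw Sw wq) q≢x) xq (adj-sym G wq))

        only-child : ∀ {w u} → x ⋖ w → S w → w ≼ u → u ≡ w
        only-child xw Sw ε        = refl
        only-child xw Sw (wv ◅ _) = contradiction wv (leaf xw Sw)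

        child∈ : ∀ {y z w} → Adj G x y → Adj G x z → y ≢ z → p ≢ y → p ≢ z → x ⋖ w → w ≡ y ⊎ w ≡ z
        child∈ xy xz y≢z p≢y p≢z xw
          with subcubic (adj-sym G (⋖-adj px)) xy xz p≢y p≢z y≢z (⋖-adj xw)
        ... | inj₁ w≡p = contradiction (sym w≡p) (p≢child xw)
        ... | inj₂ w∈  = w∈

        two-below : ∀ {y z} → y ≢ z → Adj G x y → S y → Adj G x z → S z → x ≼ y → x ≼ z → ⊥
        two-below y≢z xy Sy xz Sz ε _ = adj-irrefl G refl xy
        two-below y≢z xy Sy xz Sz _ ε = adj-irrefl G refl xz
        two-below {y} {z} y≢z xy Sy xz Sz (xw₁ ◅ w₁≼y) (xw₂ ◅ w₂≼z) =
          y≢z (trans (only-child xw₁ Sw₁ w₁≼y) (trans w₁≡w₂ (sym (only-child xw₂ Sw₂ w₂≼z))))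
          where
          in-S : ∀ {w} → x ⋖ w → S w
          in-S xw with child∈ xy xz y≢z (λ { refl → ¬Sp Sy }) (λ { refl → ¬Sp Sz }) xw
          ... | inj₁ refl = Sy
          ... | inj₂ refl = Sz
          Sw₁ = in-S xw₁
          Sw₂ = in-S xw₂
          -- The edge from p to x would lie in triangles with both children.
          w₁≡w₂ = diamond-free (⋖-adj px) (adj-sym G (proj₁ (child xw₁ Sw₁))) (⋖-adj xw₁)
                    (adj-sym G (proj₁ (child xw₂ Sw₂))) (⋖-adj xw₂)

        ¬a′~b′ : ¬ Adj G a′ b′
        ¬a′~b′ a′b′ = window a⋖b b⋖c c⋖c′
          (inj₁ Sa) (inj₁ Sb) (beside Sb bc) (beside Sb′ (a′b′⇒b′c′ a′b′))

        ≢-below : ∀ {t y} → Adj G x t → OneOfab t → x ≼ y → t ≢ y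
        ≢-below xa (inj₁ refl) x≼a refl = adj-irrefl G (sym (ancestor-of-root x≼a)) (adj-sym G xa)
        ≢-below _  (inj₂ refl) x≼b refl = deep-≢ab dx (ancestor-of-b x≼b)

        one-below : ∀ {t y} → Adj G x t → OneOfab t → Adj G x y → S y → x ≼ y → ⊥
        one-below xt t∈ab xy Sy ε = adj-irrefl G refl xy
        one-below xt t∈ab xy Sy x≼y@(xw ◅ _)
          with child∈ xt xy (≢-below xt t∈ab x≼y) (λ { refl → p-≢ab t∈ab }) (λ { refl → ¬Sp Sy }) xw
        ... | inj₁ refl = deep-≢ab (deep-child dx xw) t∈ab
        ... | inj₂ refl with outer dx t∈ab xt | proj₂ (child xw Sy)
        ...   | inj₁ refl | inj₁ refl = adj-irrefl G refl xy
        ...   | inj₁ refl | inj₂ refl = ¬a′~b′ xy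
        ...   | inj₂ refl | inj₁ refl = ¬a′~b′ (adj-sym G xy)
        ...   | inj₂ refl | inj₂ refl = adj-irrefl G refl xy

        finish : ⊥
        finish with cyclic Sx
        ... | y , z , y≢z , (xy , Sy) , (xz , Sz) with below Sy xy | below Sz xz
        ...   | inj₁ x≼y | inj₁ x≼z = two-below y≢z xy Sy xz Sz x≼y x≼z
        ...   | inj₁ x≼y | inj₂ z∈  = one-below xz z∈ xy Sy x≼y
        ...   | inj₂ y∈  | inj₁ x≼z = one-below xy y∈ xz Sz x≼z
        ...   | inj₂ (inj₁ refl) | inj₂ (inj₁ refl) = y≢z refl
        -- Here x is adjacent to both a and b, so the edge from x to a lies in a triangle.
        ...   | inj₂ (inj₁ refl) | inj₂ (inj₂ refl) = no-common dx (inj₁ refl) xy ab xz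
        ...   | inj₂ (inj₂ refl) | inj₂ (inj₁ refl) = no-common dx (inj₁ refl) xz ab xy
        ...   | inj₂ (inj₂ refl) | inj₂ (inj₂ refl) = y≢z refl

-- Decidable subsets and neighbours on a cycle

∈-tabulate⁺ : ∀ {n} {P : Pred (Fin n) 0ℓ} (P? : Decidable P) {v} → P v → v ∈ tabulate (does ∘ P?)
∈-tabulate⁺ P? {v} Pv =
  lookup⇒[]= v _ (trans (lookup∘tabulate (does ∘ P?) v) (dec-true (P? v) Pv))

∈-tabulate⁻ : ∀ {n} {P : Pred (Fin n) 0ℓ} (P? : Decidable P) {v} → v ∈ tabulate (does ∘ P?) → P v
∈-tabulate⁻ P? {v} v∈ with P? v | trans (sym (lookup∘tabulate (does ∘ P?) v)) ([]=⇒lookup v∈)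
... | yes Pv | _ = Pv

module _ (m : ℕ) where

  private
    N = 3 + m

  predecessor : ∀ (i : Fin N) → ∃[ j ] toℕ i ≡ suc (toℕ {N} j) % N
  predecessor zero    = fromℕ (2 + m) ,
    sym (trans (cong (λ k → suc k % N) (Fin.toℕ-fromℕ (2 + m))) (n%n≡0 N))
  predecessor (suc i) = inject₁ i ,
    sym (trans (cong (λ k → suc k % N) (Fin.toℕ-inject₁ i)) (m<n⇒m%n≡m (Fin.toℕ<n (suc i))))

  successor : ∀ i → ∃[ j ] toℕ {N} j ≡ suc (toℕ {N} i) % N
  successor i = fromℕ< (m%n<n (suc (toℕ i)) N) , Fin.toℕ-fromℕ< (m%n<n (suc (toℕ i)) N)

  -- Two steps forward never return, because the length is at least three. The cases record which of
  -- the two steps wraps around to 0.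
  no-2-cycle : ∀ {i j} → i < N → j < N → j ≡ suc i % N → i ≢ suc j % N
  no-2-cycle {i} {j} i<N j<N j≡ i≡ with m≤n⇒m<n∨m≡n i<N | m≤n⇒m<n∨m≡n j<N
  ... | inj₁ 1+i<N | inj₁ 1+j<N
        with refl ← trans j≡ (m<n⇒m%n≡m 1+i<N) = m≢1+n+m i {1} (trans i≡ (m<n⇒m%n≡m 1+j<N))
  ... | inj₁ 1+i<N | inj₂ refl
        with refl ← trans i≡ (n%n≡0 N) with () ← trans j≡ (m<n⇒m%n≡m 1+i<N)
  ... | inj₂ refl | inj₁ 1+j<N
        with refl ← trans j≡ (n%n≡0 N) with () ← trans i≡ (m<n⇒m%n≡m 1+j<N)
  ... | inj₂ refl | inj₂ refl with () ← trans j≡ (n%n≡0 N)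

  cycle-neighbours : ∀ i → ∃[ j ] ∃[ k ] (j ≢ k × Adj (C₃₊ m) i j × Adj (C₃₊ m) i k)
  cycle-neighbours i with successor i | predecessor i
  ... | j , i→j | k , k→i =
    j , k , (λ { refl → no-2-cycle (Fin.toℕ<n i) (Fin.toℕ<n j) i→j k→i }) , inj₁ i→j , inj₂ k→i

-- From a good root to four isolating sets

FourIsolatingSets : ∀ {n} → Graph (Fin n) → Set
FourIsolatingSets {n} G = ∃[ P ] (IsPartition {n} {4} P × (∀ i → CycleIsolating G (P i)))

module _ {n} {G : Graph (Fin n)} where

  private
    Cover = FourIsolatingSets G

  -- The image of a cycle left over by a class avoids its colour; `good` keeps it off the root, and
  -- `empty` then rules it out.
  goodRoot⇒cover : ∀ {r} → Subcubic G → (T : NormalTree G r) → GoodRoot G T → Cover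
  goodRoot⇒cover subcubic T good = class , record { disjoint = disj ; covers = cov } , isolating
    where
    open NormalTree T
    hue : Fin n → Fin 4
    hue = colour ∘ depth
    class : Fin 4 → Subset n
    class i = tabulate (does ∘ λ v → i Fin.≟ hue v)
    class⁺ : ∀ {i v} → i ≡ hue v → v ∈ class i
    class⁺ {i} = ∈-tabulate⁺ (λ v → i Fin.≟ hue v)
    class⁻ : ∀ {i v} → v ∈ class i → i ≡ hue v
    class⁻ {i} = ∈-tabulate⁻ (λ v → i Fin.≟ hue v)
    disj : ∀ {i j} → i ≢ j → Empty (class i ∩ class j)
    disj i≢j (v , v∈) with x∈p∩q⁻ _ _ v∈
    ... | v∈i , v∈j = i≢j (trans (class⁻ v∈i) (sym (class⁻ v∈j)))
    cov : ∀ v → ∃[ i ] v ∈ class i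
    cov v = hue v , class⁺ refl
    isolating : ∀ i → CycleIsolating G (class i)
    isolating i m C = TreeProperties.Avoidance.empty G T av subcubic (good av) _ (zero , refl)
      where
      open _⊑_ C
      S : Fin n → Set
      S v = ∃[ j ] value (embed j) ≡ v
      outside : ∀ j → ¬ N[ class i ] G (value (embed j))
      outside j v∈N with proof (embed j)
      ... | [ v∉N ] = ⊥-elim-irr (v∉N v∈N)
      av : Avoids G T i S
      av = record
        { cyclic = λ { (j , refl) →
            let k , l , k≢l , jk , jl = cycle-neighbours m j
            in  value (embed k) , value (embed l) , k≢l ∘ injective ∘ value-injective ,
                (preserves j k jk , k , refl) , (preserves j l jl , l , refl) }
        ; unseen = λ { (inj₁ (j , refl)) e → outside j (inj₁ (class⁺ e))
                     ; (inj₂ (_ , (j , refl) , jv)) e → outside j (inj₂ (_ , class⁺ e , jv)) }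
        }

  -- Elementary forms of the hypotheses

  no-claw : ClawFree G → NoClaw G
  no-claw cf {v} {x} {y} {z} vx vy vz x≢y x≢z y≢z with adj? G x y | adj? G x z | adj? G y z
  ... | yes xy | _      | _      = inj₁ xy
  ... | no _   | yes xz | _      = inj₂ (inj₁ xz)
  ... | no _   | no _   | yes yz = inj₂ (inj₂ yz)
  ... | no ¬xy | no ¬xz | no ¬yz = ⊥-elim (cf record
          { embed = f ; injective = λ {i} {j} → inj i j ; preserves = pres })
    where
    g : Fin 3 → Fin n
    g zero             = x
    g (suc zero)       = y
    g (suc (suc zero)) = z
    f : Fin 1 ⊎ Fin 3 → Fin n
    f (inj₁ _) = v
    f (inj₂ i) = g i
    v~g : ∀ i → Adj G v (g i)
    v~g zero             = vx
    v~g (suc zero)       = vy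
    v~g (suc (suc zero)) = vz
    g-inj : ∀ i j → g i ≡ g j → i ≡ j
    g-inj zero             zero             _ = refl
    g-inj zero             (suc zero)       e = contradiction e x≢y
    g-inj zero             (suc (suc zero)) e = contradiction e x≢z
    g-inj (suc zero)       zero             e = contradiction (sym e) x≢y
    g-inj (suc zero)       (suc zero)       _ = refl
    g-inj (suc zero)       (suc (suc zero)) e = contradiction e y≢z
    g-inj (suc (suc zero)) zero             e = contradiction (sym e) x≢z
    g-inj (suc (suc zero)) (suc zero)       e = contradiction (sym e) y≢z
    g-inj (suc (suc zero)) (suc (suc zero)) _ = refl
    independent : ∀ i j → ¬ Adj G (g i) (g j)
    independent zero             zero             = adj-irrefl G refl
    independent zero             (suc zero)       = ¬xy
    independent zero             (suc (suc zero)) = ¬xz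
    independent (suc zero)       zero             = ¬xy ∘ adj-sym G
    independent (suc zero)       (suc zero)       = adj-irrefl G refl
    independent (suc zero)       (suc (suc zero)) = ¬yz
    independent (suc (suc zero)) zero             = ¬xz ∘ adj-sym G
    independent (suc (suc zero)) (suc zero)       = ¬yz ∘ adj-sym G
    independent (suc (suc zero)) (suc (suc zero)) = adj-irrefl G refl
    inj : ∀ i j → f i ≡ f j → i ≡ j
    inj (inj₁ zero) (inj₁ zero) _ = refl
    inj (inj₁ _)    (inj₂ j)    e = contradiction e (Adj⇒≢ G (v~g j))
    inj (inj₂ i)    (inj₁ _)    e = contradiction (sym e) (Adj⇒≢ G (v~g i))
    inj (inj₂ i)    (inj₂ j)    e = cong inj₂ (g-inj i j e)
    pres : ∀ i j → Adj (K 1 3) i j ⇔ Adj G (f i) (f j)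
    pres (inj₁ _) (inj₁ _) = mk⇔ (λ ()) (adj-irrefl G refl)
    pres (inj₁ _) (inj₂ j) = mk⇔ (λ _ → v~g j) (λ _ → tt)
    pres (inj₂ i) (inj₁ _) = mk⇔ (λ _ → adj-sym G (v~g i)) (λ _ → tt)
    pres (inj₂ i) (inj₂ j) = mk⇔ (λ ()) (independent i j)

  -- A fourth neighbour would allow four successive removals from `neighbours G v`, each lowering
  -- its size.
  Δ≤3⇒subcubic : Δ G ≤ 3 → Subcubic G
  Δ≤3⇒subcubic Δ≤3 {v} {x} {y} {z} {u} vx vy vz x≢y x≢z y≢z vu
    with u Fin.≟ x | u Fin.≟ y | u Fin.≟ z
  ... | yes u≡x | _       | _       = inj₁ u≡x
  ... | no _    | yes u≡y | _       = inj₂ (inj₁ u≡y)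
  ... | no _    | no _    | yes u≡z = inj₂ (inj₂ u≡z)
  ... | no u≢x  | no u≢y  | no u≢z  = contradiction degree≤3 (<⇒≱ 4≤degree)
    where
    A = neighbours G v
    ∈A : ∀ {w} → Adj G v w → w ∈ A
    ∈A = ∈-tabulate⁺ (adj? G v)
    degree≤3 : ∣ A ∣ ≤ 3
    degree≤3 = ≤-trans (lookupAll (xs≤max 0 _) (∈-map⁺ (degree G) (∈-allFin v))) Δ≤3
    drop : ∀ {p : Subset n} {w k} → w ∈ p → k ≤ ∣ p - w ∣ → k < ∣ p ∣
    drop w∈p k≤ = ≤-trans (s≤s k≤) (x∈p⇒∣p-x∣<∣p∣ w∈p)
    4≤degree : 3 < ∣ A ∣
    4≤degree =
      drop (∈A vx) (drop (x∈p∧x≢y⇒x∈p-y (∈A vy) (≢-sym x≢y))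
        (drop (x∈p∧x≢y⇒x∈p-y (x∈p∧x≢y⇒x∈p-y (∈A vz) (≢-sym x≢z)) (≢-sym y≢z))
          (drop (x∈p∧x≢y⇒x∈p-y (x∈p∧x≢y⇒x∈p-y (x∈p∧x≢y⇒x∈p-y (∈A vu) u≢x) u≢y) u≢z) z≤n)))

  triangle≅C₃ : ∀ {r w z} → Adj G r w → Adj G r z → Adj G w z →
                (∀ v → v ≡ r ⊎ v ≡ w ⊎ v ≡ z) → G ≅ C₃₊ 0
  triangle≅C₃ {r} {w} {z} rw rz wz which = record
    { bijection = mk↔ₛ′ (λ v → code (which v)) decode code-decode (λ v → decode-code (which v))
    ; preserves = λ u v → pres (which u) (which v)
    }
    where
    code : ∀ {v} → v ≡ r ⊎ v ≡ w ⊎ v ≡ z → Fin 3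
    code (inj₁ _)        = zero
    code (inj₂ (inj₁ _)) = suc zero
    code (inj₂ (inj₂ _)) = suc (suc zero)
    decode : Fin 3 → Fin n
    decode zero             = r
    decode (suc zero)       = w
    decode (suc (suc zero)) = z
    decode-code : ∀ {v} (c : v ≡ r ⊎ v ≡ w ⊎ v ≡ z) → decode (code c) ≡ v
    decode-code (inj₁ refl)        = refl
    decode-code (inj₂ (inj₁ refl)) = refl
    decode-code (inj₂ (inj₂ refl)) = refl
    decode-injective : ∀ i j → decode i ≡ decode j → i ≡ j
    decode-injective zero             zero             _ = refl
    decode-injective zero             (suc zero)       e = contradiction e (Adj⇒≢ G rw)
    decode-injective zero             (suc (suc zero)) e = contradiction e (Adj⇒≢ G rz)
    decode-injective (suc zero)       zero             e = contradiction (sym e) (Adj⇒≢ G rw)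
    decode-injective (suc zero)       (suc zero)       _ = refl
    decode-injective (suc zero)       (suc (suc zero)) e = contradiction e (Adj⇒≢ G wz)
    decode-injective (suc (suc zero)) zero             e = contradiction (sym e) (Adj⇒≢ G rz)
    decode-injective (suc (suc zero)) (suc zero)       e = contradiction (sym e) (Adj⇒≢ G wz)
    decode-injective (suc (suc zero)) (suc (suc zero)) _ = refl
    -- `which` does not reduce on r, w, z; comparing the decoded vertices determines its value.
    code-decode : ∀ i → code (which (decode i)) ≡ i
    code-decode i = decode-injective _ i (decode-code (which (decode i)))
    pres : ∀ {u v} (c : u ≡ r ⊎ u ≡ w ⊎ u ≡ z) (d : v ≡ r ⊎ v ≡ w ⊎ v ≡ z) →
           Adj G u v ⇔ Adj (C₃₊ 0) (code c) (code d)
    pres (inj₁ refl)        (inj₁ refl)        = mk⇔ (⊥-elim ∘ adj-irrefl G refl) λ { (inj₁ ()) ; (inj₂ ()) }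
    pres (inj₁ refl)        (inj₂ (inj₁ refl)) = mk⇔ (λ _ → inj₁ refl) (λ _ → rw)
    pres (inj₁ refl)        (inj₂ (inj₂ refl)) = mk⇔ (λ _ → inj₂ refl) (λ _ → rz)
    pres (inj₂ (inj₁ refl)) (inj₁ refl)        = mk⇔ (λ _ → inj₂ refl) (λ _ → adj-sym G rw)
    pres (inj₂ (inj₁ refl)) (inj₂ (inj₁ refl)) = mk⇔ (⊥-elim ∘ adj-irrefl G refl) λ { (inj₁ ()) ; (inj₂ ()) }
    pres (inj₂ (inj₁ refl)) (inj₂ (inj₂ refl)) = mk⇔ (λ _ → inj₁ refl) (λ _ → wz)
    pres (inj₂ (inj₂ refl)) (inj₁ refl)        = mk⇔ (λ _ → inj₁ refl) (λ _ → adj-sym G rz)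
    pres (inj₂ (inj₂ refl)) (inj₂ (inj₁ refl)) = mk⇔ (λ _ → inj₂ refl) (λ _ → adj-sym G wz)
    pres (inj₂ (inj₂ refl)) (inj₂ (inj₂ refl)) = mk⇔ (⊥-elim ∘ adj-irrefl G refl) λ { (inj₁ ()) ; (inj₂ ()) }

  -- Choosing the root and the first vertices of the search

  four-path : ∀ {r w v u} → Adj G r w → Adj G w v → Adj G v u →
              v ≢ r → u ≢ r → u ≢ w → Path G r (u ∷ v ∷ w ∷ r ∷ [])
  four-path rw wv vu v≢r u≢r u≢w =
    extend _ (extend _ (extend _ ([ _ ] refl) rw
      λ { (here refl) → adj-irrefl G refl rw }) wv
      λ { (here refl) → adj-irrefl G refl wv ; (there (here v≡r)) → v≢r v≡r }) vu
      λ { (here refl) → adj-irrefl G refl vu ; (there (here u≡w)) → u≢w u≡w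
        ; (there (there (here u≡r))) → u≢r u≡r }

  -- Since r, w, v, u start a branch, a cycle through r that sees the other three sees every colour,
  -- so r is a good root.
  path⇒cover : Connected G → Subcubic G → ∀ {r w v u} → Adj G r w → Adj G w v → Adj G v u →
               v ≢ r → u ≢ r → u ≢ w →
               (∀ {S} → Cyclic G S → S r → Seen G S w × Seen G S v × Seen G S u) → Cover
  path⇒cover conn subcubic rw wv vu v≢r u≢r u≢w seen
    with normalTree conn (four-path rw wv vu v≢r u≢r u≢w)
  ... | T , vu⋖ ∷ wv⋖ ∷ rw⋖ ∷ [-] = goodRoot⇒cover subcubic T good
    where
    good : GoodRoot G T
    good av Sr =
      let sw , sv , su = seen (Avoids.cyclic av) Sr
      in  TreeProperties.Avoidance.window G T av rw⋖ wv⋖ vu⋖ (inj₁ Sr) sw sv su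

  module Cases (conn : Connected G) (claw-free : NoClaw G) (subcubic : Subcubic G)
               (¬C₃ : ¬ (G ≅ C₃₊ 0)) where

    Outside : Fin n → Fin n → Fin n → Set
    Outside v p q = ∃[ x ] (Adj G v x × x ≢ p × x ≢ q)

    outside? : ∀ v p q → Dec (Outside v p q)
    outside? v p q = Fin.any? λ x → adj? G v x ×-dec ¬? (x Fin.≟ p) ×-dec ¬? (x Fin.≟ q)

    ¬outside⇒ : ∀ {v p q} → ¬ Outside v p q → ∀ {x} → Adj G v x → x ≡ p ⊎ x ≡ q
    ¬outside⇒ {p = p} {q} ¬o {x} vx with x Fin.≟ p | x Fin.≟ q
    ... | yes x≡p | _       = inj₁ x≡p
    ... | no _    | yes x≡q = inj₂ x≡q
    ... | no x≢p  | no x≢q  = contradiction (x , vx , x≢p , x≢q) ¬o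

    degree≤1⇒cover : ∀ {r s} → (∀ {x} → Adj G r x → x ≡ s) → Cover
    degree≤1⇒cover {r} {s} only with normalTree conn ([ r ] refl)
    ... | T , _ = goodRoot⇒cover subcubic T λ av Sr →
      let _ , y≢s , ry , _ = cyclic-≢ G (Avoids.cyclic av) Sr s in y≢s (only ry)

    -- The path s, p, t, q lies in the closed neighbourhood of its root s.
    diamond⇒cover : ∀ {s t p q} → Adj G s t → Adj G s p → Adj G t p → Adj G s q → Adj G t q →
                    p ≢ q → Cover
    diamond⇒cover st sp tp sq tq p≢q =
      path⇒cover conn subcubic sp (adj-sym G tp) tq (≢-sym (Adj⇒≢ G st)) (≢-sym (Adj⇒≢ G sq))
        (≢-sym p≢q) λ _ Ss → inj₂ (_ , Ss , sp) , inj₂ (_ , Ss , st) , inj₂ (_ , Ss , sq)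

    -- Every cycle through z contains w, whose closed neighbourhood is {z, r, w, w′}.
    triangle⇒cover : ∀ {r w z w′} → Adj G r w → Adj G r z → Adj G w z →
                     (∀ {x} → Adj G r x → x ≡ w ⊎ x ≡ z) →
                     Adj G w w′ → w′ ≢ r → w′ ≢ z → Cover
    triangle⇒cover {r} {w} {z} {w′} rw rz wz only ww′ w′≢r w′≢z =
      path⇒cover conn subcubic (adj-sym G rz) rw ww′ (Adj⇒≢ G wz) w′≢z w′≢r λ cyc Sz →
        let Sw = w∈S cyc Sz in inj₂ (_ , Sw , adj-sym G rw) , inj₁ Sw , inj₂ (_ , Sw , ww′)
      where
      -- Besides r and w, z has at most one neighbour, so S contains r or w; from r the cycle must
      -- go on to w.
      w∈S : ∀ {S} → Cyclic G S → S z → S w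
      w∈S {S} cyc Sz with cyc Sz
      ... | y , x , y≢x , (zy , Sy) , (zx , Sx) with y Fin.≟ r | y Fin.≟ w
      ...   | yes refl | _        = forced G cyc only Sy
      ...   | no _     | yes refl = Sy
      ...   | no y≢r   | no y≢w
              with subcubic (adj-sym G rz) (adj-sym G wz) zy (Adj⇒≢ G rw) (≢-sym y≢r) (≢-sym y≢w) zx
      ...     | inj₁ refl        = forced G cyc only Sx
      ...     | inj₂ (inj₁ refl) = Sx
      ...     | inj₂ (inj₂ x≡y)  = contradiction (sym x≡y) y≢x

    spans : ∀ {r w z} → (∀ {x} → Adj G r x → x ≡ w ⊎ x ≡ z) → (∀ {x} → Adj G w x → x ≡ r ⊎ x ≡ z) →
            (∀ {x} → Adj G z x → x ≡ r ⊎ x ≡ w) → ∀ v → v ≡ r ⊎ v ≡ w ⊎ v ≡ z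
    spans {r} {w} {z} only-r only-w only-z v = go (conn r v) (inj₁ refl)
      where
      go : ∀ {u v} → Star (Adj G) u v → u ≡ r ⊎ u ≡ w ⊎ u ≡ z → v ≡ r ⊎ v ≡ w ⊎ v ≡ z
      go ε          u∈ = u∈
      go (ux ◅ x→v) (inj₁ refl)        = go x→v (inj₂ (only-r ux))
      go (ux ◅ x→v) (inj₂ (inj₁ refl)) with only-w ux
      ... | inj₁ e = go x→v (inj₁ e)
      ... | inj₂ e = go x→v (inj₂ (inj₂ e))
      go (ux ◅ x→v) (inj₂ (inj₂ refl)) with only-z ux
      ... | inj₁ e = go x→v (inj₁ e)
      ... | inj₂ e = go x→v (inj₂ (inj₁ e))

    module _ (another : ∀ v p → ∃[ x ] (Adj G v x × x ≢ p)) where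

      -- A cycle through r contains w. If w has two more neighbours v and u, claw-freeness at w
      -- makes them adjacent, and r, w, v, u lies in the closed neighbourhood of w.
      no-triangle⇒cover : ∀ {r w z} → Adj G r w → (∀ {x} → Adj G r x → x ≡ w ⊎ x ≡ z) →
                          (∀ {x} → Adj G r x → ¬ Adj G w x) → Cover
      no-triangle⇒cover {r} {w} {z} rw only apart with another w r
      ... | v , wv , v≢r with outside? w r v
      ...   | yes (u , wu , u≢r , u≢v) =
        path⇒cover conn subcubic rw wv vu v≢r u≢r (≢-sym (Adj⇒≢ G wu)) λ cyc Sr →
          let Sw = forced G cyc only Sr in inj₁ Sw , inj₂ (_ , Sw , wv) , inj₂ (_ , Sw , wu)
        where
        vu : Adj G v u
        vu with claw-free (adj-sym G rw) wv wu (≢-sym v≢r) (≢-sym u≢r) (≢-sym u≢v)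
        ... | inj₁ rv        = contradiction wv (apart rv)
        ... | inj₂ (inj₁ ru) = contradiction wu (apart ru)
        ... | inj₂ (inj₂ vu) = vu
      -- Only r and v are neighbours of w, so the cycle also contains v and sees any further
      -- neighbour u of v.
      ...   | no ¬o with another v w
      ...     | u , vu , u≢w =
        path⇒cover conn subcubic rw wv vu v≢r (λ { refl → apart (adj-sym G vu) wv }) u≢w λ cyc Sr →
          let Sw = forced G cyc only Sr
              Sv = forced G cyc (swap ∘ ¬outside⇒ ¬o) Sw
          in  inj₁ Sw , inj₁ Sv , inj₂ (_ , Sv , vu)

      degree2⇒cover : ∀ {r w z} → Adj G r w → Adj G r z → w ≢ z →
                      (∀ {x} → Adj G r x → x ≡ w ⊎ x ≡ z) → Cover
      degree2⇒cover {r} {w} {z} rw rz w≢z only with adj? G w z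
      ... | no ¬wz = no-triangle⇒cover rw only apart
        where
        apart : ∀ {x} → Adj G r x → ¬ Adj G w x
        apart rx wx with only rx
        ... | inj₁ refl = adj-irrefl G refl wx
        ... | inj₂ refl = ¬wz wx
      ... | yes wz with outside? w r z | outside? z r w
      ...   | yes (w′ , ww′ , w′≢r , w′≢z) | _ = triangle⇒cover rw rz wz only ww′ w′≢r w′≢z
      ...   | no _ | yes (z′ , zz′ , z′≢r , z′≢w) =
              triangle⇒cover rz rw (adj-sym G wz) (swap ∘ only) zz′ z′≢r z′≢w
      -- No edge leaves the triangle, so by connectedness it is all of G.
      ...   | no ¬w | no ¬z = contradiction
              (triangle≅C₃ rw rz wz (spans only (¬outside⇒ ¬w) (¬outside⇒ ¬z))) ¬C₃

    module _ (diamond-free : DiamondFree G) (degree-3 : MinDegree3 G) where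

      ordered-triangle⇒cover : ∀ {a b c a′ b′ c′} → Triangle G a b c a′ b′ c′ →
                               (Adj G a′ b′ → Adj G b′ c′) → Cover
      ordered-triangle⇒cover tri star
        with normalTree conn (four-path ab bc cc′ (≢-sym (Adj⇒≢ G ac)) c′≢a c′≢b)
        where open Triangle tri
      ... | T , cc′⋖ ∷ bc⋖ ∷ ab⋖ ∷ [-] = goodRoot⇒cover subcubic T
            (TriangleRoot.good subcubic claw-free diamond-free degree-3 tri star T ab⋖ bc⋖ cc′⋖)

      rotate : ∀ {a b c a′ b′ c′} → Triangle G a b c a′ b′ c′ →
               Triangle G b c a b′ c′ a′
      rotate tri = record
        { ab = bc ; ac = adj-sym G ab ; bc = adj-sym G ac ; aa′ = bb′ ; bb′ = cc′ ; cc′ = aa′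
        ; a′≢b = b′≢c ; a′≢c = b′≢a ; b′≢a = c′≢b ; b′≢c = c′≢a ; c′≢a = a′≢b ; c′≢b = a′≢c }
        where open Triangle tri

      -- If a′ ~ b′ but b′ ≁ c′, the triangle read as b, c, a satisfies the condition.
      any-triangle⇒cover : ∀ {a b c a′ b′ c′} → Triangle G a b c a′ b′ c′ → Cover
      any-triangle⇒cover {a′ = a′} {b′} {c′} tri with adj? G a′ b′ | adj? G b′ c′
      ... | no ¬a′b′ | _        = ordered-triangle⇒cover tri λ a′b′ → contradiction a′b′ ¬a′b′
      ... | yes _    | yes b′c′ = ordered-triangle⇒cover tri λ _ → b′c′
      ... | yes _    | no ¬b′c′ = ordered-triangle⇒cover (rotate tri) λ b′c′ → contradiction b′c′ ¬b′c′

      triangle-at : ∀ {a b c a′} → Adj G a b → Adj G a c → Adj G a a′ → Adj G b c →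
                    a′ ≢ b → a′ ≢ c → Cover
      triangle-at {a} {b} {c} ab ac aa′ bc a′≢b a′≢c with degree-3 b a c | degree-3 c a b
      ... | _ , bb′ , b′≢a , b′≢c | _ , cc′ , c′≢a , c′≢b = any-triangle⇒cover record
        { ab = ab ; ac = ac ; bc = bc ; aa′ = aa′ ; bb′ = bb′ ; cc′ = cc′
        ; a′≢b = a′≢b ; a′≢c = a′≢c ; b′≢a = b′≢a ; b′≢c = b′≢c ; c′≢a = c′≢a ; c′≢b = c′≢b }

      cubic⇒cover : Fin n → Cover
      -- Excluding nothing new, then x, then x and y, produces three distinct neighbours;
      -- claw-freeness joins two of them into a triangle with a.
      cubic⇒cover a with degree-3 a a a
      ... | x , ax , _ with degree-3 a x x
      ...   | y , ay , y≢x , _ with degree-3 a x y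
      ...     | z , az , z≢x , z≢y with claw-free ax ay az (≢-sym y≢x) (≢-sym z≢x) (≢-sym z≢y)
      ...       | inj₁ xy        = triangle-at ax ay az xy z≢x z≢y
      ...       | inj₂ (inj₁ xz) = triangle-at ax az ay xz y≢x (≢-sym z≢y)
      ...       | inj₂ (inj₂ yz) = triangle-at ay az ax yz (≢-sym y≢x) (≢-sym z≢x)

-- Assembling the cases

theorem1p11 : (n : ℕ) (G : Graph (Fin n)) →
    Connected G → ClawFree G → Δ G ≤ 3 → ¬ (G ≅ C₃₊ 0) →
    ∃[ P ] (IsPartition {n} {4} P × (∀ i → CycleIsolating G (P i)))
-- Without vertices all classes are empty, and a cycle would supply a vertex.
theorem1p11 zero    G _    _  _   _   =
  (λ _ → []ᵥ) , record { disjoint = λ { _ (() , _) } ; covers = λ () } ,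
  λ _ _ C → case value (_⊑_.embed C zero) of λ ()
theorem1p11 (suc n) G conn cf Δ≤3 ¬C₃ = search
  where
  V = Fin (suc n)
  open Cases {G = G} conn (no-claw {G = G} cf) (Δ≤3⇒subcubic {G = G} Δ≤3) ¬C₃

  Another : V → V → Set
  Another v p = ∃[ x ] (Adj G v x × x ≢ p)

  another? : ∀ v p → Dec (Another v p)
  another? v p = Fin.any? λ x → adj? G v x ×-dec ¬? (x Fin.≟ p)

  -- The cases are a vertex of degree at most one, a diamond, a vertex of degree two, and the cubic
  -- diamond-free graphs that remain.
  search : FourIsolatingSets G
  search with Fin.all? (λ v → Fin.all? (another? v))
  ... | no ¬another =
    let r , ¬r = Fin.¬∀⟶∃¬ _ _ (λ v → Fin.all? (another? v)) ¬another
        s , ¬o = Fin.¬∀⟶∃¬ _ _ (another? r) ¬r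
    in  degree≤1⇒cover λ {x} rx → decidable-stable (x Fin.≟ s) λ x≢s → ¬o (x , rx , x≢s)
  ... | yes another with Fin.any? (λ s → Fin.any? λ t → Fin.any? λ p → Fin.any? λ q →
          adj? G s t ×-dec adj? G s p ×-dec adj? G t p ×-dec adj? G s q ×-dec adj? G t q
            ×-dec ¬? (p Fin.≟ q))
  ...   | yes (_ , _ , _ , _ , st , sp , tp , sq , tq , p≢q) = diamond⇒cover st sp tp sq tq p≢q
  ...   | no ¬diamond with Fin.all? (λ v → Fin.all? λ p → Fin.all? (outside? v p))
  ...     | yes degree-3 = cubic⇒cover (λ st sp tp sq tq → decidable-stable (_ Fin.≟ _) λ p≢q →
              ¬diamond (_ , _ , _ , _ , st , sp , tp , sq , tq , p≢q)) degree-3 zero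
  ...     | no ¬degree-3 =
    let r , ¬r = Fin.¬∀⟶∃¬ _ _ (λ v → Fin.all? λ p → Fin.all? (outside? v p)) ¬degree-3
        p , ¬p = Fin.¬∀⟶∃¬ _ _ (λ p → Fin.all? (outside? r p)) ¬r
        q , ¬q = Fin.¬∀⟶∃¬ _ _ (outside? r p) ¬p
    -- All neighbours of r are among p and q, and r has a neighbour other than each of them, so both
    -- are neighbours.
    in  two-neighbours (¬outside⇒ ¬q) (another r q) (another r p)
    where
    two-neighbours : ∀ {r p q} → (∀ {x} → Adj G r x → x ≡ p ⊎ x ≡ q) →
                     Another r q → Another r p → FourIsolatingSets G
    two-neighbours only (w , rw , w≢q) (z , rz , z≢p) with only rw | only rz
    ... | inj₂ w≡q  | _         = contradiction w≡q w≢q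
    ... | _         | inj₁ z≡p  = contradiction z≡p z≢p
    ... | inj₁ refl | inj₂ refl = degree2⇒cover another rw rz w≢q only
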